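{- Let $d,q\in\mathbb N^+$ with $q\ge 2$ and let $A=A(H(d,q))$ be the adjacency matrix of the Hamming graph $H(d,q)$. If $q\ge 3$, then no positive power of $A$ has PST between distinct vertices. If $q=2$, then PST under a positive power of $A$ can occur between distinct vertices only when they are antipodal.
   Context: $\mathbb N^+=\{1,2,3,\ldots\}$. The vertices of the Hamming graph $H(d,q)$ are the words of length $d$ over an alphabet of size $q$; two words are adjacent when their Hamming distance is one. For $q=2$, two vertices are antipodal when they are at Hamming distance $d$. A positive power of $A$ is $A^k$ with $k\in\mathbb N^+$. A real symmetric matrix $K$ indexed by a finite vertex set has perfect state transfer (PST) from vertex $a$ to vertex $b$ if $\exp(-\mathrm i\tau K)e_a=\gamma e_b$ for some $\tau>0$ and some $\gamma\in\mathbb C$ with $|\gamma|=1$, where $e_v$ is the standard basis vector indexed by $v$. -}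

module Defs where

open import Algebra.Bundles.Raw using (RawRing)
open import Data.Bool.Base using (if_then_else_)
open import Data.Fin.Base using (Fin)
import Data.Fin.Properties as Fin
open import Data.Integer.Base using (+_)
open import Data.List.Base using (List; []; _∷_; map; foldr; allFin; upTo; cartesianProductWith)
open import Data.List.Membership.Propositional using (_∈_)
open import Data.List.Membership.Propositional.Properties using (∈-allFin; ∈-cartesianProductWith⁺)
open import Data.List.Relation.Unary.All using ([])
open import Data.List.Relation.Unary.AllPairs using ([]; _∷_)
open import Data.List.Relation.Unary.Any using (here)
open import Data.List.Relation.Unary.Unique.Propositional using (Unique)
open import Data.List.Relation.Unary.Unique.Propositional.Properties
  using (allFin⁺; cartesianProductWith⁺)
open import Data.Nat.Base as ℕ using (ℕ; zero; suc; _!)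
import Data.Nat.Properties as ℕ
open import Data.Product.Base using (Σ; ∃; _×_; _,_)
open import Data.Rational.Base as ℚ
  using (ℚ; 0ℚ; 1ℚ; ½; _+_; _*_; _-_; -_; ∣_∣; _<_; _≤_; 1/_; Positive; NonNegative; NonZero)
open import Data.Rational.Properties hiding (_≟_)
open import Data.Rational.Solver using (module +-*-Solver)
open import Data.Sum.Base using (inj₁; inj₂)
open import Data.Vec.Base using (Vec; []; _∷_)
import Data.Vec.Properties as Vec
open import Level using (0ℓ)
open import Relation.Binary.Core using (Rel)
open import Relation.Binary.Definitions using (Decidable; DecidableEquality; Symmetric; Irreflexive)
open import Relation.Binary.PropositionalEquality
open import Relation.Nullary using (¬_; does; yes; no)
open import Relation.Nullary.Negation using (contradiction)

------------------------------------------------------------------------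
-- Real numbers: Cauchy sequences of rationals, compared by the setoid
-- equality _≈ℝ_ (the difference tends to 0)

Eventually : (ℕ → Set) → Set
Eventually P = ∃ λ N → ∀ n → N ℕ.≤ n → P n

IsCauchy : (ℕ → ℚ) → Set
IsCauchy f = ∀ ε → 0ℚ < ε →
  ∃ λ N → ∀ m n → N ℕ.≤ m → N ℕ.≤ n → ∣ f m - f n ∣ < ε

private
  0<½* : ∀ {ε} → 0ℚ < ε → 0ℚ < ½ * ε
  0<½* {ε} 0<ε = positive⁻¹ (½ * ε) {{pos*pos⇒pos ½ ε {{ℚ.positive 0<ε}}}}

  ½+½ : ∀ ε → ½ * ε + ½ * ε ≡ ε
  ½+½ ε = trans (sym (*-distribʳ-+ ε ½ ½)) (*-identityˡ ε)

  ∣p∣≤∣p-q∣+∣q∣ : ∀ p q → ∣ p ∣ ≤ ∣ p - q ∣ + ∣ q ∣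
  ∣p∣≤∣p-q∣+∣q∣ p q =
    subst (λ z → ∣ z ∣ ≤ ∣ p - q ∣ + ∣ q ∣)
      (solve 2 (λ p q → (p :- q) :+ q := p) refl p q)
      (∣p+q∣≤∣p∣+∣q∣ (p - q) q)
    where open +-*-Solver

  ∣p-q∣≡∣q-p∣ : ∀ p q → ∣ p - q ∣ ≡ ∣ q - p ∣
  ∣p-q∣≡∣q-p∣ p q = trans (sym (∣-p∣≡∣p∣ (p - q)))
    (cong ∣_∣ (solve 2 (λ p q → :- (p :- q) := q :- p) refl p q))
    where open +-*-Solver

  ∣p∣-∣q∣≤∣p-q∣ : ∀ p q → ∣ p ∣ - ∣ q ∣ ≤ ∣ p - q ∣
  ∣p∣-∣q∣≤∣p-q∣ p q =
    subst (∣ p ∣ - ∣ q ∣ ≤_)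
      (solve 2 (λ a b → (a :+ b) :- b := a) refl ∣ p - q ∣ ∣ q ∣)
      (+-monoˡ-≤ (- ∣ q ∣) (∣p∣≤∣p-q∣+∣q∣ p q))
    where open +-*-Solver

  ∣∣p∣-∣q∣∣≤∣p-q∣ : ∀ p q → ∣ ∣ p ∣ - ∣ q ∣ ∣ ≤ ∣ p - q ∣
  ∣∣p∣-∣q∣∣≤∣p-q∣ p q with ∣p∣≡p∨∣p∣≡-p (∣ p ∣ - ∣ q ∣)
  ... | inj₁ eq = subst (_≤ ∣ p - q ∣) (sym eq) (∣p∣-∣q∣≤∣p-q∣ p q)
  ... | inj₂ eq = subst₂ _≤_
    (trans (solve 2 (λ a b → b :- a := :- (a :- b)) refl ∣ p ∣ ∣ q ∣) (sym eq))
    (∣p-q∣≡∣q-p∣ q p)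
    (∣p∣-∣q∣≤∣p-q∣ q p)
    where open +-*-Solver

const-cauchy : ∀ p → IsCauchy (λ _ → p)
const-cauchy p ε 0<ε = 0 , λ _ _ _ _ →
  subst (_< ε) (sym (cong ∣_∣ (+-inverseʳ p))) 0<ε

+-cauchy : ∀ f g → IsCauchy f → IsCauchy g → IsCauchy (λ n → f n + g n)
+-cauchy f g cf cg ε 0<ε with cf (½ * ε) (0<½* 0<ε) | cg (½ * ε) (0<½* 0<ε)
... | M , fM | N , gN = M ℕ.⊔ N , λ m n M⊔N≤m M⊔N≤n → begin-strict
    ∣ (f m + g m) - (f n + g n) ∣
      ≡⟨ cong ∣_∣ (solve 4 (λ a b c d → (a :+ b) :- (c :+ d) := (a :- c) :+ (b :- d))
                    refl (f m) (g m) (f n) (g n)) ⟩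
    ∣ (f m - f n) + (g m - g n) ∣
      ≤⟨ ∣p+q∣≤∣p∣+∣q∣ (f m - f n) (g m - g n) ⟩
    ∣ f m - f n ∣ + ∣ g m - g n ∣
      <⟨ +-mono-< (fM m n (ℕ.m⊔n≤o⇒m≤o M N M⊔N≤m) (ℕ.m⊔n≤o⇒m≤o M N M⊔N≤n))
                  (gN m n (ℕ.m⊔n≤o⇒n≤o M N M⊔N≤m) (ℕ.m⊔n≤o⇒n≤o M N M⊔N≤n)) ⟩
    ½ * ε + ½ * ε
      ≡⟨ ½+½ ε ⟩
    ε ∎
  where
  open ≤-Reasoning
  open +-*-Solver

neg-cauchy : ∀ f → IsCauchy f → IsCauchy (λ n → - f n)
neg-cauchy f cf ε 0<ε with cf ε 0<ε
... | N , fN = N , λ m n N≤m N≤n →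
  subst (_< ε)
    (trans (∣p-q∣≡∣q-p∣ (f m) (f n))
      (cong ∣_∣ (solve 2 (λ a b → b :- a := (:- a) :- (:- b)) refl (f m) (f n))))
    (fN m n N≤m N≤n)
  where open +-*-Solver

abs-cauchy : ∀ f → IsCauchy f → IsCauchy (λ n → ∣ f n ∣)
abs-cauchy f cf ε 0<ε with cf ε 0<ε
... | N , fN = N , λ m n N≤m N≤n →
  ≤-<-trans (∣∣p∣-∣q∣∣≤∣p-q∣ (f m) (f n)) (fN m n N≤m N≤n)

cauchy⇒bounded : ∀ f → IsCauchy f →
  ∃ λ B → 0ℚ ≤ B × Eventually (λ n → ∣ f n ∣ ≤ B)
cauchy⇒bounded f cf with cf 1ℚ (positive⁻¹ 1ℚ)
... | N , fN = 1ℚ + ∣ f N ∣ , +-mono-≤ {0ℚ} {1ℚ} {0ℚ} (nonNegative⁻¹ 1ℚ) (0≤∣p∣ (f N)) ,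
  N , λ n N≤n → ≤-trans (∣p∣≤∣p-q∣+∣q∣ (f n) (f N))
    (+-monoˡ-≤ ∣ f N ∣ (<⇒≤ (fN n N N≤n ℕ.≤-refl)))

private
  product-bound : ∀ p q {P Q} → 0ℚ ≤ P → ∣ p ∣ ≤ P → ∣ q ∣ ≤ Q → ∣ p * q ∣ ≤ P * Q
  product-bound p q {P} {Q} 0≤P p≤P q≤Q = begin
    ∣ p * q ∣      ≡⟨ ∣p*q∣≡∣p∣*∣q∣ p q ⟩
    ∣ p ∣ * ∣ q ∣  ≤⟨ *-monoʳ-≤-nonNeg ∣ q ∣ {{∣-∣-nonNeg q}} p≤P ⟩
    P * ∣ q ∣      ≤⟨ *-monoˡ-≤-nonNeg P {{ℚ.nonNegative 0≤P}} q≤Q ⟩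
    P * Q          ∎
    where open ≤-Reasoning

  product-difference : ∀ a b c d → a * b - c * d ≡ a * (b - d) + d * (a - c)
  product-difference = solve 4 (λ a b c d →
    a :* b :- c :* d := a :* (b :- d) :+ d :* (a :- c)) refl
    where open +-*-Solver

  divide : ∀ D ε → 0ℚ < D → 0ℚ < ε → ∃ λ δ → 0ℚ < δ × D * δ ≡ ε
  divide D ε 0<D 0<ε = 1/ D * ε ,
    positive⁻¹ (1/ D * ε) {{pos*pos⇒pos (1/ D) {{1/pos⇒pos D}} ε {{ℚ.positive 0<ε}}}} ,
    trans (sym (*-assoc D (1/ D) ε))
      (trans (cong (_* ε) (*-inverseʳ D)) (*-identityˡ ε))
    where
    instance
      D-pos : Positive D
      D-pos = ℚ.positive 0<D

      D≢0 : NonZero D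
      D≢0 = pos⇒nonZero D

  p<1+p : ∀ p → p < 1ℚ + p
  p<1+p p = subst (_< 1ℚ + p) (+-identityˡ p) (+-monoˡ-< p (positive⁻¹ 1ℚ))

*-cauchy : ∀ f g → IsCauchy f → IsCauchy g → IsCauchy (λ n → f n * g n)
*-cauchy f g cf cg ε 0<ε =
  let B , 0≤B , M₁ , fB = cauchy⇒bounded f cf
      C , 0≤C , M₂ , gC = cauchy⇒bounded g cg
      0≤B+C = +-mono-≤ {0ℚ} {B} {0ℚ} {C} 0≤B 0≤C
      δ , 0<δ , Dδ≡ε = divide (1ℚ + (B + C)) ε (≤-<-trans 0≤B+C (p<1+p (B + C))) 0<ε
      N₁ , fN = cf δ 0<δ
      N₂ , gN = cg δ 0<δ
  in (M₁ ℕ.⊔ M₂) ℕ.⊔ (N₁ ℕ.⊔ N₂) , λ m n ≤m ≤n →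
    let M≤m  = ℕ.m⊔n≤o⇒m≤o (M₁ ℕ.⊔ M₂) (N₁ ℕ.⊔ N₂) ≤m
        M≤n  = ℕ.m⊔n≤o⇒m≤o (M₁ ℕ.⊔ M₂) (N₁ ℕ.⊔ N₂) ≤n
        N≤m  = ℕ.m⊔n≤o⇒n≤o (M₁ ℕ.⊔ M₂) (N₁ ℕ.⊔ N₂) ≤m
        N≤n  = ℕ.m⊔n≤o⇒n≤o (M₁ ℕ.⊔ M₂) (N₁ ℕ.⊔ N₂) ≤n
    in bound B C δ ε 0≤B 0≤C 0<δ Dδ≡ε (f m) (g m) (f n) (g n)
         (fB m (ℕ.m⊔n≤o⇒m≤o M₁ M₂ M≤m))
         (gC n (ℕ.m⊔n≤o⇒n≤o M₁ M₂ M≤n))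
         (<⇒≤ (fN m n (ℕ.m⊔n≤o⇒m≤o N₁ N₂ N≤m) (ℕ.m⊔n≤o⇒m≤o N₁ N₂ N≤n)))
         (<⇒≤ (gN m n (ℕ.m⊔n≤o⇒n≤o N₁ N₂ N≤m) (ℕ.m⊔n≤o⇒n≤o N₁ N₂ N≤n)))
  where
  open ≤-Reasoning

  bound : ∀ B C δ ε → 0ℚ ≤ B → 0ℚ ≤ C → 0ℚ < δ → (1ℚ + (B + C)) * δ ≡ ε →
    ∀ a b c d → ∣ a ∣ ≤ B → ∣ d ∣ ≤ C → ∣ a - c ∣ ≤ δ → ∣ b - d ∣ ≤ δ →
    ∣ a * b - c * d ∣ < ε
  bound B C δ ε 0≤B 0≤C 0<δ Dδ≡ε a b c d a≤B d≤C a-c≤δ b-d≤δ = begin-strict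
    ∣ a * b - c * d ∣
      ≡⟨ cong ∣_∣ (product-difference a b c d) ⟩
    ∣ a * (b - d) + d * (a - c) ∣
      ≤⟨ ∣p+q∣≤∣p∣+∣q∣ (a * (b - d)) (d * (a - c)) ⟩
    ∣ a * (b - d) ∣ + ∣ d * (a - c) ∣
      ≤⟨ +-mono-≤ (product-bound a (b - d) 0≤B a≤B b-d≤δ)
                  (product-bound d (a - c) 0≤C d≤C a-c≤δ) ⟩
    B * δ + C * δ
      ≡⟨ *-distribʳ-+ δ B C ⟨
    (B + C) * δ
      <⟨ *-monoˡ-<-pos δ {{ℚ.positive 0<δ}} (p<1+p (B + C)) ⟩
    (1ℚ + (B + C)) * δ
      ≡⟨ Dδ≡ε ⟩
    ε ∎

record ℝ : Set where
  constructor mkℝ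
  field
    seq    : ℕ → ℚ
    cauchy : IsCauchy seq

open ℝ public

infix  8 -ℝ_
infixl 7 _*ℝ_
infixl 6 _+ℝ_ _-ℝ_
infix  4 _≈ℝ_ _<ℝ_ _≤ℝ_

fromℚ : ℚ → ℝ
fromℚ p = mkℝ (λ _ → p) (const-cauchy p)

0ℝ 1ℝ : ℝ
0ℝ = fromℚ 0ℚ
1ℝ = fromℚ 1ℚ

_+ℝ_ _*ℝ_ : ℝ → ℝ → ℝ
x +ℝ y = mkℝ (λ n → seq x n + seq y n) (+-cauchy (seq x) (seq y) (cauchy x) (cauchy y))
x *ℝ y = mkℝ (λ n → seq x n * seq y n) (*-cauchy (seq x) (seq y) (cauchy x) (cauchy y))

-ℝ_ ∣_∣ℝ : ℝ → ℝ
-ℝ x = mkℝ (λ n → - seq x n) (neg-cauchy (seq x) (cauchy x))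
∣ x ∣ℝ = mkℝ (λ n → ∣ seq x n ∣) (abs-cauchy (seq x) (cauchy x))

_-ℝ_ : ℝ → ℝ → ℝ
x -ℝ y = x +ℝ (-ℝ y)

_≈ℝ_ _<ℝ_ _≤ℝ_ : Rel ℝ 0ℓ
x ≈ℝ y = ∀ ε → 0ℚ < ε → Eventually λ n → ∣ seq x n - seq y n ∣ < ε
-- The sequences must stay a fixed positive rational apart: the pointwise
-- strict order would also relate equal reals.
x <ℝ y = ∃ λ ε → 0ℚ < ε × Eventually λ n → seq x n + ε ≤ seq y n
x ≤ℝ y = ¬ (y <ℝ x)

ℝ-rawRing : RawRing 0ℓ 0ℓ
ℝ-rawRing = record
  { Carrier = ℝ ; _≈_ = _≈ℝ_ ; _+_ = _+ℝ_ ; _*_ = _*ℝ_ ; -_ = -ℝ_ ; 0# = 0ℝ ; 1# = 1ℝ }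

Converges : (ℕ → ℝ) → ℝ → Set
Converges s x = ∀ ε → 0ℝ <ℝ ε → Eventually λ n → ∣ s n -ℝ x ∣ℝ <ℝ ε

------------------------------------------------------------------------
-- Complex numbers

record ℂ : Set where
  constructor mkℂ
  field
    re im : ℝ

open ℂ public

infix  8 -ℂ_
infixl 7 _*ℂ_
infixl 6 _+ℂ_
infix  4 _≈ℂ_

fromℝ : ℝ → ℂ
fromℝ x = mkℂ x 0ℝ

0ℂ 1ℂ 𝕚 : ℂ
0ℂ = fromℝ 0ℝ
1ℂ = fromℝ 1ℝ
𝕚  = mkℂ 0ℝ 1ℝ

_+ℂ_ _*ℂ_ : ℂ → ℂ → ℂ
z +ℂ w = mkℂ (re z +ℝ re w) (im z +ℝ im w)
z *ℂ w = mkℂ (re z *ℝ re w -ℝ im z *ℝ im w) (re z *ℝ im w +ℝ im z *ℝ re w)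

-ℂ_ : ℂ → ℂ
-ℂ z = mkℂ (-ℝ re z) (-ℝ im z)

_≈ℂ_ : Rel ℂ 0ℓ
z ≈ℂ w = re z ≈ℝ re w × im z ≈ℝ im w

ℂ-rawRing : RawRing 0ℓ 0ℓ
ℂ-rawRing = record
  { Carrier = ℂ ; _≈_ = _≈ℂ_ ; _+_ = _+ℂ_ ; _*_ = _*ℂ_ ; -_ = -ℂ_ ; 0# = 0ℂ ; 1# = 1ℂ }

-- HasModulus z r says |z| = r, that is, r is the nonnegative square root of
-- (re z)² + (im z)².
HasModulus : ℂ → ℝ → Set
HasModulus z r = 0ℝ ≤ℝ r × r *ℝ r ≈ℝ re z *ℝ re z +ℝ im z *ℝ im z

Convergesℂ : (ℕ → ℂ) → ℂ → Set
Convergesℂ s z = Converges (λ n → re (s n)) (re z) × Converges (λ n → im (s n)) (im z)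

------------------------------------------------------------------------
-- Vectors and matrices indexed by a finite set

record FiniteSet : Set₁ where
  field
    Carrier  : Set
    _≟_      : DecidableEquality Carrier
    elements : List Carrier
    complete : ∀ v → v ∈ elements
    unique   : Unique elements

module LinearAlgebra (V : FiniteSet) (R : RawRing 0ℓ 0ℓ) where
  open FiniteSet V using (_≟_; elements) renaming (Carrier to I)
  open RawRing R renaming (_+_ to _+ᴿ_; _*_ to _*ᴿ_)

  Vector Matrix : Set
  Vector = I → Carrier
  Matrix = I → I → Carrier

  infix  4 _≈ᵥ_
  infixl 7 _·_ _·ᵥ_
  infixr 7 _•_ _•ᵥ_
  infixr 8 _^_

  _≈ᵥ_ : Vector → Vector → Set
  x ≈ᵥ y = ∀ v → x v ≈ y v

  ∑ : (I → Carrier) → Carrier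
  ∑ f = foldr _+ᴿ_ 0# (map f elements)

  basis : I → Vector
  basis a v = if does (a ≟ v) then 1# else 0#

  identity : Matrix
  identity u v = if does (u ≟ v) then 1# else 0#

  _·_ : Matrix → Matrix → Matrix
  (M · N) u v = ∑ λ w → M u w *ᴿ N w v

  _·ᵥ_ : Matrix → Vector → Vector
  (M ·ᵥ x) u = ∑ λ w → M u w *ᴿ x w

  _•_ : Carrier → Matrix → Matrix
  (c • M) u v = c *ᴿ M u v

  _•ᵥ_ : Carrier → Vector → Vector
  (c •ᵥ x) v = c *ᴿ x v

  _^_ : Matrix → ℕ → Matrix
  M ^ zero  = identity
  M ^ suc k = M · (M ^ k)

1/_! : ℕ → ℚ
1/ k ! = ℚ._/_ (+ 1) (k ℕ.!) {{k ℕ.!≢0}}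

module _ (V : FiniteSet) where
  open FiniteSet V using () renaming (Carrier to I)

  private
    module R = LinearAlgebra V ℝ-rawRing
    module C = LinearAlgebra V ℂ-rawRing

  expPartialSum : C.Matrix → ℕ → C.Matrix
  expPartialSum M n u v =
    foldr _+ℂ_ 0ℂ (map (λ k → fromℝ (fromℚ (1/ k !)) *ℂ (M C.^ k) u v) (upTo n))

  -- E = exp(M): the exponential series of M converges entrywise to E.
  IsExp : C.Matrix → C.Matrix → Set
  IsExp M E = ∀ u v → Convergesℂ (λ n → expPartialSum M n u v) (E u v)

  complexify : R.Matrix → C.Matrix
  complexify K u v = fromℝ (K u v)

  PST : R.Matrix → I → I → Set
  PST K a b =
    Σ ℝ λ τ → 0ℝ <ℝ τ ×
    Σ ℂ λ γ → HasModulus γ 1ℝ ×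
    Σ C.Matrix λ E → IsExp ((-ℂ (𝕚 *ℂ fromℝ τ)) C.• complexify K) E ×
    E C.·ᵥ C.basis a C.≈ᵥ γ C.•ᵥ C.basis b

------------------------------------------------------------------------
-- Graphs

record Graph : Set₁ where
  field
    vertices  : FiniteSet

  open FiniteSet vertices public using () renaming (Carrier to Vertex)

  field
    Adjacent  : Rel Vertex 0ℓ
    adjacent? : Decidable Adjacent
    symmetric : Symmetric Adjacent
    loopless  : Irreflexive _≡_ Adjacent

module _ (G : Graph) where
  open Graph G

  adjacencyMatrix : LinearAlgebra.Matrix vertices ℝ-rawRing
  adjacencyMatrix u v = if does (adjacent? u v) then 1ℝ else 0ℝ

Word : ℕ → ℕ → Set
Word d q = Vec (Fin q) d

hammingDistance : ∀ {d q} → Word d q → Word d q → ℕ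
hammingDistance []       []       = 0
hammingDistance (x ∷ xs) (y ∷ ys) =
  (if does (x Fin.≟ y) then 0 else 1) ℕ.+ hammingDistance xs ys

hammingDistance-sym : ∀ {d q} (u v : Word d q) → hammingDistance u v ≡ hammingDistance v u
hammingDistance-sym []       []       = refl
hammingDistance-sym (x ∷ xs) (y ∷ ys) with x Fin.≟ y | y Fin.≟ x
... | yes _   | yes _   = hammingDistance-sym xs ys
... | no _    | no _    = cong suc (hammingDistance-sym xs ys)
... | yes x≡y | no y≢x  = contradiction (sym x≡y) y≢x
... | no x≢y  | yes y≡x = contradiction (sym y≡x) x≢y

hammingDistance-refl : ∀ {d q} (u : Word d q) → hammingDistance u u ≡ 0
hammingDistance-refl []       = refl
hammingDistance-refl (x ∷ xs) with x Fin.≟ x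
... | yes _  = hammingDistance-refl xs
... | no x≢x = contradiction refl x≢x

words : ∀ d q → List (Word d q)
words zero    q = [] ∷ []
words (suc d) q = cartesianProductWith _∷_ (allFin q) (words d q)

words-complete : ∀ {d q} (w : Word d q) → w ∈ words d q
words-complete []       = here refl
words-complete (x ∷ xs) = ∈-cartesianProductWith⁺ _∷_ (∈-allFin x) (words-complete xs)

words-unique : ∀ d q → Unique (words d q)
words-unique zero    q = [] ∷ []
words-unique (suc d) q =
  cartesianProductWith⁺ _∷_ Vec.∷-injective (allFin⁺ q) (words-unique d q)

wordSet : ℕ → ℕ → FiniteSet
wordSet d q = record
  { Carrier  = Word d q
  ; _≟_      = Vec.≡-dec Fin._≟_
  ; elements = words d q
  ; complete = words-complete
  ; unique   = words-unique d q
  }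

hammingGraph : ℕ → ℕ → Graph
hammingGraph d q = record
  { vertices  = wordSet d q
  ; Adjacent  = λ u v → hammingDistance u v ≡ 1
  ; adjacent? = λ u v → hammingDistance u v ℕ.≟ 1
  ; symmetric = λ {u} {v} → trans (hammingDistance-sym v u)
  ; loopless  = λ { {u} refl d≡1 → contradiction (trans (sym (hammingDistance-refl u)) d≡1) λ () }
  }

Antipodal : ∀ {d q} → Word d q → Word d q → Set
Antipodal {d} u v = hammingDistance u v ≡ d

adjacencyPower : ∀ d q → ℕ → LinearAlgebra.Matrix (wordSet d q) ℝ-rawRing
adjacencyPower d q k = adjacencyMatrix (hammingGraph d q) ^ k
  where open LinearAlgebra (wordSet d q) ℝ-rawRing

{-# OPTIONS --safe #-}

-- exp(-iτA^k) commutes with every automorphism of the graph, so under PST from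
-- a to b the stabiliser of a in the automorphism group must fix b.  If b ≠ a
-- and there is a third letter, a transposition of letters in a coordinate where
-- a and b differ fixes a and moves b.  If a and b agree in some coordinate and
-- differ in another, then they do so in two consecutive ones, and exchanging
-- these two coordinates, after relabelling letters so that a is fixed, moves b.
module Submission where

open import Defs
open import Algebra.Bundles.Raw using (RawRing)
open import Algebra.Definitions using (Congruent₂)
import Algebra.Properties.CommutativeSemigroup as CommutativeSemigroup
open import Algebra.Structures using (IsCommutativeMonoid)
open import Algebra.Structures.Biased using (isCommutativeMonoidˡ)
open import Data.Bool.Base using (true; false; if_then_else_)
open import Data.Fin.Base using (Fin; zero; suc)
import Data.Fin.Properties as Fin
open import Data.Fin.Permutation.Components using (transpose)
open import Data.List.Base using ([]; _∷_; map; foldr; upTo)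
open import Data.List.Membership.Propositional using (_∈_)
open import Data.List.Membership.Propositional.Properties using (∈-map⁺)
open import Data.List.Membership.Propositional.Properties.WithK using (unique∧set⇒bag)
open import Data.List.Properties using (map-∘)
open import Data.List.Relation.Binary.BagAndSetEquality using (∼bag⇒↭)
open import Data.List.Relation.Binary.Permutation.Propositional using (_↭_; ↭⇒↭ₛ′)
open import Data.List.Relation.Binary.Permutation.Propositional.Properties using (map⁺)
import Data.List.Relation.Binary.Permutation.Setoid.Properties as Permutation
open import Data.List.Relation.Unary.Unique.Propositional.Properties
  using () renaming (map⁺ to unique-map⁺)
open import Data.Nat.Base as ℕ using (ℕ; zero; suc; _≤_; s≤s)
import Data.Nat.Properties as ℕ
open import Data.Product.Base using (∃; _×_; _,_)
open import Data.Rational.Base as ℚ using (ℚ; 0ℚ; 1ℚ; ½)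
import Data.Rational.Properties as ℚ
open import Data.Rational.Solver using (module +-*-Solver)
open import Data.Sum.Base using (_⊎_; inj₁; inj₂)
open import Data.Vec.Base using ([]; _∷_)
import Data.Vec.Properties as Vec
open import Function.Base using (_∘_)
open import Function.Bundles using (mk⇔)
open import Level using (0ℓ)
open import Relation.Binary.Core using (Rel)
open import Relation.Binary.PropositionalEquality
  using (_≡_; _≢_; refl; sym; trans; cong; cong₂; subst; subst₂)
open import Relation.Binary.Structures using (IsEquivalence)
open import Relation.Nullary using (¬_; Dec; _because_; does; yes; no)
open import Relation.Nullary.Decidable using (dec-true; dec-false; decidable-stable; does-⇔)
open import Relation.Nullary.Negation using (contradiction)

-- Termwise equality and limits

infix 4 _≐_ _≐ℂ_ _≋ℂ_

-- A record rather than a function, so that x and y can be inferred from the type.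
record _≐_ (x y : ℝ) : Set where
  constructor termwise
  field terms : ∀ n → seq x n ≡ seq y n

open _≐_

infixr 4 _,_

-- Abstract in the relation, so that one argument serves both `_≐_`, under which finite sums and
-- products are compared, and `_≈ℝ_`, which enters once limits are taken.
record Componentwise (_∼_ : Rel ℝ 0ℓ) (z w : ℂ) : Set where
  constructor _,_
  field
    re-∼ : re z ∼ re w
    im-∼ : im z ∼ im w

open Componentwise

_≐ℂ_ _≋ℂ_ : Rel ℂ 0ℓ
_≐ℂ_ = Componentwise _≐_
_≋ℂ_ = Componentwise _≈ℝ_

both : ∀ {P Q : ℕ → Set} → Eventually P → Eventually Q → Eventually (λ n → P n × Q n)
both (M , p) (N , q) = M ℕ.⊔ N , λ n M⊔N≤n →
  p n (ℕ.m⊔n≤o⇒m≤o M N M⊔N≤n) , q n (ℕ.m⊔n≤o⇒n≤o M N M⊔N≤n)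

eventually-map : ∀ {P Q : ℕ → Set} → (∀ n → P n → Q n) → Eventually P → Eventually Q
eventually-map f (N , p) = N , λ n N≤n → f n (p n N≤n)

dist : ℚ → ℚ → ℚ
dist p q = ℚ.∣ p ℚ.- q ∣

dist-sym : ∀ p q → dist p q ≡ dist q p
dist-sym p q = trans (sym (ℚ.∣-p∣≡∣p∣ (p ℚ.- q)))
  (cong ℚ.∣_∣ (solve 2 (λ p q → :- (p :- q) := q :- p) refl p q))
  where open +-*-Solver

dist-triangle : ∀ p q r → dist p r ℚ.≤ dist p q ℚ.+ dist q r
dist-triangle p q r =
  subst (λ z → ℚ.∣ z ∣ ℚ.≤ dist p q ℚ.+ dist q r)
    (solve 3 (λ p q r → (p :- q) :+ (q :- r) := p :- r) refl p q r)
    (ℚ.∣p+q∣≤∣p∣+∣q∣ (p ℚ.- q) (q ℚ.- r))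
  where open +-*-Solver

dist-+ : ∀ p q r s → dist (p ℚ.+ q) (r ℚ.+ s) ℚ.≤ dist p r ℚ.+ dist q s
dist-+ p q r s =
  subst (λ z → ℚ.∣ z ∣ ℚ.≤ dist p r ℚ.+ dist q s)
    (solve 4 (λ p q r s → (p :- r) :+ (q :- s) := (p :+ q) :- (r :+ s)) refl p q r s)
    (ℚ.∣p+q∣≤∣p∣+∣q∣ (p ℚ.- r) (q ℚ.- s))
  where open +-*-Solver

0<½* : ∀ {ε} → 0ℚ ℚ.< ε → 0ℚ ℚ.< ½ ℚ.* ε
0<½* {ε} 0<ε = ℚ.positive⁻¹ (½ ℚ.* ε) {{ℚ.pos*pos⇒pos ½ ε {{ℚ.positive 0<ε}}}}

half-sum-< : ∀ {p q r} ε → r ℚ.≤ p ℚ.+ q → p ℚ.< ½ ℚ.* ε → q ℚ.< ½ ℚ.* ε → r ℚ.< ε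
half-sum-< ε r≤p+q p<½ε q<½ε = ℚ.≤-<-trans r≤p+q
  (subst (_ ℚ.<_) (trans (sym (ℚ.*-distribʳ-+ ε ½ ½)) (ℚ.*-identityˡ ε))
    (ℚ.+-mono-< p<½ε q<½ε))

≐⇒≈ : ∀ x y → x ≐ y → x ≈ℝ y
≐⇒≈ x y (termwise x≐y) ε 0<ε = 0 , λ n _ → subst (ℚ._< ε)
  (sym (cong ℚ.∣_∣ (trans (cong (ℚ._- seq y n) (x≐y n)) (ℚ.+-inverseʳ (seq y n))))) 0<ε

≈ℝ-isEquivalence : IsEquivalence _≈ℝ_
≈ℝ-isEquivalence = record
  { refl  = λ {x} → ≐⇒≈ x x (termwise λ _ → refl)
  ; sym   = λ {x} {y} x≈y ε 0<ε → eventually-map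
      (λ n → subst (ℚ._< ε) (dist-sym (seq x n) (seq y n))) (x≈y ε 0<ε)
  ; trans = λ {x} {y} {z} x≈y y≈z ε 0<ε → eventually-map
      (λ n (p , q) → half-sum-< ε (dist-triangle (seq x n) (seq y n) (seq z n)) p q)
      (both (x≈y _ (0<½* 0<ε)) (y≈z _ (0<½* 0<ε)))
  }

+ℝ-cong : Congruent₂ _≈ℝ_ _+ℝ_
+ℝ-cong {x} {y} {u} {v} x≈y u≈v ε 0<ε = eventually-map
  (λ n (p , q) → half-sum-< ε (dist-+ (seq x n) (seq u n) (seq y n) (seq v n)) p q)
  (both (x≈y _ (0<½* 0<ε)) (u≈v _ (0<½* 0<ε)))

-- Fix one index `N` at which `s N` and `t N` are both within half of `ε` of their limits. For large
-- `m` the common `m`-th term of `s N` and `t N` then serves as the intermediate point in the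
-- triangle inequality.
limit-unique : ∀ {s t} x y → (∀ n → s n ≐ t n) → Converges s x → Converges t y → x ≈ℝ y
limit-unique {s} {t} x y s≐t s→x t→y ε 0<ε =
  let N , near = both (s→x (fromℚ (½ ℚ.* ε)) 0<½ε) (t→y (fromℚ (½ ℚ.* ε)) 0<½ε)
      (δ , 0<δ , nx) , (δ′ , 0<δ′ , ny) = near N ℕ.≤-refl
  in eventually-map (λ m (p , q) → half-sum-< ε
       (ℚ.≤-trans (dist-triangle (seq x m) (seq (s N) m) (seq y m))
         (ℚ.≤-reflexive (cong₂ ℚ._+_ (dist-sym (seq x m) (seq (s N) m))
           (cong (λ z → dist z (seq y m)) (terms (s≐t N) m)))))
       (shrink (dist (seq (s N) m) (seq x m)) 0<δ p)
       (shrink (dist (seq (t N) m) (seq y m)) 0<δ′ q)) (both nx ny)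
  where
  0<½ε : 0ℝ <ℝ fromℚ (½ ℚ.* ε)
  0<½ε = ½ ℚ.* ε , 0<½* 0<ε , 0 , λ _ _ → ℚ.≤-reflexive (ℚ.+-identityˡ _)

  -- `_<ℝ_` supplies a rational gap `δ`; dropping it leaves a strict inequality of terms.
  shrink : ∀ {δ q} p → 0ℚ ℚ.< δ → p ℚ.+ δ ℚ.≤ q → p ℚ.< q
  shrink {δ} p 0<δ p+δ≤q = ℚ.<-≤-trans
    (subst (ℚ._< p ℚ.+ δ) (ℚ.+-identityʳ p) (ℚ.+-monoʳ-< p 0<δ)) p+δ≤q

limit-uniqueℂ : ∀ {s t} z w → (∀ n → s n ≐ℂ t n) → Convergesℂ s z → Convergesℂ t w → z ≋ℂ w
limit-uniqueℂ {s} {t} z w s≐t (re→ , im→) (re→′ , im→′) =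
  limit-unique {re ∘ s} {re ∘ t} (re z) (re w) (re-∼ ∘ s≐t) re→ re→′ ,
  limit-unique {im ∘ s} {im ∘ t} (im z) (im w) (im-∼ ∘ s≐t) im→ im→′

-- Addition of real and complex numbers as a commutative monoid

+ℝ-≐-isCommutativeMonoid : IsCommutativeMonoid _≐_ _+ℝ_ 0ℝ
+ℝ-≐-isCommutativeMonoid = isCommutativeMonoidˡ record
  { isSemigroup = record
    { isMagma = record
      { isEquivalence = record
        { refl  = termwise λ _ → refl
        ; sym   = λ (termwise p) → termwise (sym ∘ p)
        ; trans = λ (termwise p) (termwise q) → termwise λ n → trans (p n) (q n)
        }
      ; ∙-cong = λ (termwise p) (termwise q) → termwise λ n → cong₂ ℚ._+_ (p n) (q n)
      }
    ; assoc = λ x y z → termwise λ n → ℚ.+-assoc (seq x n) (seq y n) (seq z n)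
    }
  ; identityˡ = λ x → termwise λ n → ℚ.+-identityˡ (seq x n)
  ; comm = λ x y → termwise λ n → ℚ.+-comm (seq x n) (seq y n)
  }

+ℝ-isCommutativeMonoid : IsCommutativeMonoid _≈ℝ_ _+ℝ_ 0ℝ
+ℝ-isCommutativeMonoid = isCommutativeMonoidˡ record
  { isSemigroup = record
    { isMagma = record
      { isEquivalence = ≈ℝ-isEquivalence
      ; ∙-cong = λ {x} {y} {u} {v} → +ℝ-cong {x} {y} {u} {v}
      }
    ; assoc = λ x y z → ≐⇒≈ (x +ℝ y +ℝ z) (x +ℝ (y +ℝ z)) (assoc x y z)
    }
  ; identityˡ = λ x → ≐⇒≈ (0ℝ +ℝ x) x (identityˡ x)
  ; comm = λ x y → ≐⇒≈ (x +ℝ y) (y +ℝ x) (comm x y)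
  }
  where open IsCommutativeMonoid +ℝ-≐-isCommutativeMonoid

componentwise-isCommutativeMonoid :
  ∀ {_∼_ : Rel ℝ 0ℓ} {_+_ : ℝ → ℝ → ℝ} {0# : ℝ} → IsCommutativeMonoid _∼_ _+_ 0# →
  IsCommutativeMonoid (Componentwise _∼_)
    (λ z w → mkℂ (re z + re w) (im z + im w)) (mkℂ 0# 0#)
componentwise-isCommutativeMonoid isCM = isCommutativeMonoidˡ record
  { isSemigroup = record
    { isMagma = record
      { isEquivalence = record
        { refl  = M.refl , M.refl
        ; sym   = λ (p , q) → M.sym p , M.sym q
        ; trans = λ (p , q) (p′ , q′) → M.trans p p′ , M.trans q q′
        }
      ; ∙-cong = λ (p , q) (p′ , q′) → M.∙-cong p p′ , M.∙-cong q q′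
      }
    ; assoc = λ x y z → M.assoc (re x) (re y) (re z) , M.assoc (im x) (im y) (im z)
    }
  ; identityˡ = λ x → M.identityˡ (re x) , M.identityˡ (im x)
  ; comm = λ x y → M.comm (re x) (re y) , M.comm (im x) (im y)
  }
  where module M = IsCommutativeMonoid isCM

+ℂ-isCommutativeMonoid : ∀ {_∼_ : Rel ℝ 0ℓ} → IsCommutativeMonoid _∼_ _+ℝ_ 0ℝ →
  IsCommutativeMonoid (Componentwise _∼_) _+ℂ_ 0ℂ
+ℂ-isCommutativeMonoid isCM = componentwise-isCommutativeMonoid isCM

-- Congruence of multiplication

*ℝ-≐-cong : Congruent₂ _≐_ _*ℝ_
*ℝ-≐-cong (termwise p) (termwise q) = termwise λ n → cong₂ ℚ._*_ (p n) (q n)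

*ℂ-≐-cong : Congruent₂ _≐ℂ_ _*ℂ_
*ℂ-≐-cong (termwise p , termwise q) (termwise p′ , termwise q′) =
  (termwise λ n → cong₂ ℚ._-_ (cong₂ ℚ._*_ (p n) (p′ n)) (cong₂ ℚ._*_ (q n) (q′ n))) ,
  (termwise λ n → cong₂ ℚ._+_ (cong₂ ℚ._*_ (p n) (q′ n)) (cong₂ ℚ._*_ (q n) (p′ n)))

-- Unlike _≐ℂ_ this unfolds to equations between rationals, so that converting
-- between two forms of it never compares Cauchy proofs.
SameTerms : Rel ℂ 0ℓ
SameTerms z w = (∀ n → seq (re z) n ≡ seq (re w) n) × (∀ n → seq (im z) n ≡ seq (im w) n)

sameTerms⇒≐ℂ : ∀ {z w} → SameTerms z w → z ≐ℂ w
sameTerms⇒≐ℂ (p , q) = termwise p , termwise q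

*ℂ-sameTerms : ∀ c {z w} → z ≐ℂ w → SameTerms (c *ℂ z) (c *ℂ w)
*ℂ-sameTerms c (termwise p , termwise q) =
  (λ n → cong₂ ℚ._-_ (cong (seq (re c) n ℚ.*_) (p n)) (cong (seq (im c) n ℚ.*_) (q n))) ,
  (λ n → cong₂ ℚ._+_ (cong (seq (re c) n ℚ.*_) (q n)) (cong (seq (im c) n ℚ.*_) (p n)))

module ≋ℂ = IsCommutativeMonoid (+ℂ-isCommutativeMonoid +ℝ-isCommutativeMonoid)

≈⇒≋ℂ : ∀ {z w} → z ≈ℂ w → z ≋ℂ w
≈⇒≋ℂ (p , q) = p , q

≋⇒≈ℂ : ∀ {z w} → z ≋ℂ w → z ≈ℂ w
≋⇒≈ℂ (p , q) = p , q

≐⇒≋ℂ : ∀ z w → z ≐ℂ w → z ≋ℂ w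
≐⇒≋ℂ z w (p , q) = ≐⇒≈ (re z) (re w) p , ≐⇒≈ (im z) (im w) q

*ℂ-identityʳ : ∀ z → z *ℂ 1ℂ ≋ℂ z
*ℂ-identityʳ z = ≐⇒≋ℂ (z *ℂ 1ℂ) z
  ( (termwise λ n → trans
      (cong₂ ℚ._-_ (ℚ.*-identityʳ (seq (re z) n)) (ℚ.*-zeroʳ (seq (im z) n)))
      (ℚ.+-identityʳ (seq (re z) n)))
  , (termwise λ n → trans
      (cong₂ ℚ._+_ (ℚ.*-zeroʳ (seq (re z) n)) (ℚ.*-identityʳ (seq (im z) n)))
      (ℚ.+-identityˡ (seq (im z) n))))

*ℂ-zeroʳ : ∀ z → z *ℂ 0ℂ ≋ℂ 0ℂ
*ℂ-zeroʳ z = ≐⇒≋ℂ (z *ℂ 0ℂ) 0ℂ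
  ( (termwise λ n → cong₂ ℚ._-_ (ℚ.*-zeroʳ (seq (re z) n)) (ℚ.*-zeroʳ (seq (im z) n)))
  , (termwise λ n → cong₂ ℚ._+_ (ℚ.*-zeroʳ (seq (re z) n)) (ℚ.*-zeroʳ (seq (im z) n))))

-- For a factor 1 or 0, as in a basis vector, the unit and zero laws suffice; a general factor would
-- call for a boundedness estimate under `_≈ℝ_`.
*ℂ-congˡ-01 : ∀ {x z w} → x ≡ 1ℂ ⊎ x ≡ 0ℂ → z ≋ℂ w → z *ℂ x ≋ℂ w *ℂ x
*ℂ-congˡ-01 {x} {z} {w} (inj₁ refl) z≋w =
  ≋ℂ.trans {z *ℂ 1ℂ} {z} {w *ℂ 1ℂ} (*ℂ-identityʳ z)
    (≋ℂ.trans {z} {w} {w *ℂ 1ℂ} z≋w (≋ℂ.sym {w *ℂ 1ℂ} {w} (*ℂ-identityʳ w)))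
*ℂ-congˡ-01 {x} {z} {w} (inj₂ refl) _   =
  ≋ℂ.trans {z *ℂ 0ℂ} {0ℂ} {w *ℂ 0ℂ} (*ℂ-zeroʳ z) (≋ℂ.sym {w *ℂ 0ℂ} {0ℂ} (*ℂ-zeroʳ w))

-- Spelled so that `basis a v` over the complex numbers unfolds to `indicator (a ≟ v)`.
indicator : ∀ {P : Set} → Dec P → ℂ
indicator P? = if does P? then 1ℂ else 0ℂ

indicator-cong : ∀ {P Q : Set} (P? : Dec P) (Q? : Dec Q) → does P? ≡ does Q? →
  indicator P? ≡ indicator Q?
indicator-cong _ _ = cong (if_then 1ℂ else 0ℂ)

indicator-yes : ∀ {P : Set} (P? : Dec P) → P → indicator P? ≡ 1ℂ
indicator-yes P? p = cong (if_then 1ℂ else 0ℂ) (dec-true P? p)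

indicator-no : ∀ {P : Set} (P? : Dec P) → ¬ P → indicator P? ≡ 0ℂ
indicator-no P? ¬p = cong (if_then 1ℂ else 0ℂ) (dec-false P? ¬p)

indicator-01 : ∀ {P : Set} (P? : Dec P) → indicator P? ≡ 1ℂ ⊎ indicator P? ≡ 0ℂ
indicator-01 (true  because _) = inj₁ refl
indicator-01 (false because _) = inj₂ refl

-- At a late enough index both parts of `γ` would be below 1/2 in absolute value, so their squares
-- would add up to at most 1/2, while that sum also lies less than 1/2 away from 1.
modulus-1⇒≉0 : ∀ γ → HasModulus γ 1ℝ → ¬ (γ ≋ℂ 0ℂ)
modulus-1⇒≉0 γ (_ , 1≈∣γ∣²) (re≈0 , im≈0) =
  let N , near = both (1≈∣γ∣² ½ 0<½) (both (re≈0 ½ 0<½) (im≈0 ½ 0<½))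
      d , p , q = near N ℕ.≤-refl
  in ℚ.<-irrefl refl (contradictory (seq (re γ) N) (seq (im γ) N) d p q)
  where
  open ℚ.≤-Reasoning

  0<½ : 0ℚ ℚ.< ½
  0<½ = ℚ.positive⁻¹ ½

  ∣p²∣≤¼ : ∀ p → dist p 0ℚ ℚ.< ½ → ℚ.∣ p ℚ.* p ∣ ℚ.≤ ½ ℚ.* ½
  ∣p²∣≤¼ p p<½ = begin
    ℚ.∣ p ℚ.* p ∣        ≡⟨ ℚ.∣p*q∣≡∣p∣*∣q∣ p p ⟩
    ℚ.∣ p ∣ ℚ.* ℚ.∣ p ∣  ≤⟨ ℚ.*-monoʳ-≤-nonNeg ℚ.∣ p ∣ {{ℚ.∣-∣-nonNeg p}} ∣p∣≤½ ⟩
    ½ ℚ.* ℚ.∣ p ∣        ≤⟨ ℚ.*-monoˡ-≤-nonNeg ½ ∣p∣≤½ ⟩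
    ½ ℚ.* ½              ∎
    where
    ∣p∣≤½ : ℚ.∣ p ∣ ℚ.≤ ½
    ∣p∣≤½ = ℚ.<⇒≤ (subst (λ z → ℚ.∣ z ∣ ℚ.< ½) (ℚ.+-identityʳ p) p<½)

  contradictory : ∀ p q → dist 1ℚ (p ℚ.* p ℚ.+ q ℚ.* q) ℚ.< ½ →
    dist p 0ℚ ℚ.< ½ → dist q 0ℚ ℚ.< ½ → 1ℚ ℚ.< 1ℚ
  -- Both ends of the chain compute to `1ℚ`.
  contradictory p q d p<½ q<½ = begin-strict
    dist 1ℚ 0ℚ
      ≤⟨ dist-triangle 1ℚ s 0ℚ ⟩
    dist 1ℚ s ℚ.+ dist s 0ℚ
      ≡⟨ cong (λ z → dist 1ℚ s ℚ.+ ℚ.∣ z ∣) (ℚ.+-identityʳ s) ⟩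
    dist 1ℚ s ℚ.+ ℚ.∣ s ∣
      <⟨ ℚ.+-mono-<-≤ d (ℚ.≤-trans (ℚ.∣p+q∣≤∣p∣+∣q∣ (p ℚ.* p) (q ℚ.* q))
           (ℚ.+-mono-≤ (∣p²∣≤¼ p p<½) (∣p²∣≤¼ q q<½))) ⟩
    ½ ℚ.+ (½ ℚ.* ½ ℚ.+ ½ ℚ.* ½)
      ∎
    where s = p ℚ.* p ℚ.+ q ℚ.* q

-- Matrices invariant under an involution

-- The index type is arbitrary: vertices for matrix products, exponents for the partial sums of the
-- exponential.
foldr-cong : ∀ {A I : Set} {_∼_ : Rel A 0ℓ} {_∙_ ε} → IsCommutativeMonoid _∼_ _∙_ ε →
  ∀ {f g : I → A} → (∀ i → f i ∼ g i) → ∀ is → foldr _∙_ ε (map f is) ∼ foldr _∙_ ε (map g is)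
foldr-cong isCM f∼g []       = IsCommutativeMonoid.refl isCM
foldr-cong isCM f∼g (i ∷ is) =
  IsCommutativeMonoid.∙-cong isCM (f∼g i) (foldr-cong isCM f∼g is)

module Invariance (V : FiniteSet)
  (σ : FiniteSet.Carrier V → FiniteSet.Carrier V) (σ-involutive : ∀ v → σ (σ v) ≡ v) where

  open FiniteSet V using (_≟_; elements; complete; unique) renaming (Carrier to I)

  σ-injective : ∀ {u v} → σ u ≡ σ v → u ≡ v
  σ-injective {u} {v} eq = trans (sym (σ-involutive u)) (trans (cong σ eq) (σ-involutive v))

  -- Both lists are free of repetitions and contain every vertex, `v` being the image of `σ v`;
  -- hence they agree as bags.
  elements-permuted : map σ elements ↭ elements
  elements-permuted = ∼bag⇒↭ (unique∧set⇒bag (unique-map⁺ σ-injective unique) unique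
    (λ {v} → mk⇔ (λ _ → complete v)
      (λ _ → subst (_∈ map σ elements) (σ-involutive v) (∈-map⁺ σ (complete (σ v))))))

  does-≟-invariant : ∀ u v → does (σ u ≟ σ v) ≡ does (u ≟ v)
  does-≟-invariant u v = does-⇔ (mk⇔ σ-injective (cong σ)) (σ u ≟ σ v) (u ≟ v)

  -- Instantiated three times below: `RealSums` for the powers of the adjacency matrix,
  -- `ComplexSums` for the terms of the exponential series, and `LimitSums` for the limit, where
  -- equality is no longer termwise.
  module Sums (R : RawRing 0ℓ 0ℓ) {_∼_ : Rel (RawRing.Carrier R) 0ℓ}
    (isCM : IsCommutativeMonoid _∼_ (RawRing._+_ R) (RawRing.0# R)) where

    open RawRing R using (_+_; _*_; 0#; 1#) renaming (Carrier to A)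
    open LinearAlgebra V R using (∑)

    private
      module M = IsCommutativeMonoid isCM

    ∑-reindex : ∀ f → ∑ (f ∘ σ) ∼ ∑ f
    ∑-reindex f = subst (λ xs → foldr _+_ 0# xs ∼ ∑ f) (sym (map-∘ elements))
      (Permutation.foldr-commMonoid M.setoid isCM
        (↭⇒↭ₛ′ M.isEquivalence (map⁺ f elements-permuted)))

    -- Substitution of `σ w` for the summation variable. In the applications `f` is a summand with
    -- its outer indices moved by `σ`, and `g` the same summand with them unmoved.
    ∑-invariant : ∀ {f g} → (∀ w → f (σ w) ∼ g w) → ∑ f ∼ ∑ g
    ∑-invariant {f} fσ∼g =
      M.trans (M.sym (∑-reindex f)) (foldr-cong isCM fσ∼g elements)

    -- Entrywise form of commuting with the permutation matrix of `σ`.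
    Invariant : (I → I → A) → Set
    Invariant M = ∀ u v → M (σ u) (σ v) ∼ M u v

    module Powers (*-cong : Congruent₂ _∼_ _*_) where
      open LinearAlgebra V R using (Matrix; identity; _·_; _^_)

      identity-invariant : Invariant identity
      identity-invariant u v =
        M.reflexive (cong (if_then 1# else 0#) (does-≟-invariant u v))

      ·-invariant : ∀ {M N} → Invariant M → Invariant N → Invariant (M · N)
      ·-invariant M-inv N-inv u v = ∑-invariant λ w → *-cong (M-inv u w) (N-inv w v)

      ^-invariant : ∀ {M} → Invariant M → ∀ k → Invariant (M ^ k)
      ^-invariant M-inv zero    = identity-invariant
      ^-invariant M-inv (suc k) = ·-invariant M-inv (^-invariant M-inv k)

  module RealSums = Sums ℝ-rawRing +ℝ-≐-isCommutativeMonoid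
  module RealPowers = RealSums.Powers *ℝ-≐-cong
  module ComplexSums = Sums ℂ-rawRing (+ℂ-isCommutativeMonoid +ℝ-≐-isCommutativeMonoid)
  module ComplexPowers = ComplexSums.Powers *ℂ-≐-cong
  module LimitSums = Sums ℂ-rawRing (+ℂ-isCommutativeMonoid +ℝ-isCommutativeMonoid)

  open LinearAlgebra V ℂ-rawRing using (∑; _^_)

  -- The powers and sums in the definitions of IsExp and PST belong to private
  -- modules; F, f and g below stand for their summands and are left to inference.
  limit-invariant : ∀ {F : ℕ → I → I → ℂ} E → (∀ k → ComplexSums.Invariant (F k)) →
    (∀ u v → Convergesℂ (λ n → foldr _+ℂ_ 0ℂ (map (λ k → F k u v) (upTo n))) (E u v)) →
    LimitSums.Invariant E
  limit-invariant {F} E F-inv F→E u v = limit-uniqueℂ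
    {λ n → foldr _+ℂ_ 0ℂ (map (λ k → F k (σ u) (σ v)) (upTo n))}
    {λ n → foldr _+ℂ_ 0ℂ (map (λ k → F k u v) (upTo n))}
    (E (σ u) (σ v)) (E u v)
    (λ n → foldr-cong (+ℂ-isCommutativeMonoid +ℝ-≐-isCommutativeMonoid)
      {λ k → F k (σ u) (σ v)} {λ k → F k u v} (λ k → F-inv k u v) (upTo n))
    (F→E (σ u) (σ v)) (F→E u v)

  expTerm-invariant : ∀ {M} → ComplexSums.Invariant M → ∀ k u v →
    SameTerms (fromℝ (fromℚ (1/ k !)) *ℂ (M ^ k) (σ u) (σ v))
              (fromℝ (fromℚ (1/ k !)) *ℂ (M ^ k) u v)
  expTerm-invariant {M} M-inv k u v = *ℂ-sameTerms (fromℝ (fromℚ (1/ k !)))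
    (ComplexPowers.^-invariant {M} M-inv k u v)

  scaled-invariant : ∀ {K} → RealSums.Invariant K → ∀ c u v →
    SameTerms (c *ℂ fromℝ (K (σ u) (σ v))) (c *ℂ fromℝ (K u v))
  scaled-invariant {K} K-inv c u v =
    *ℂ-sameTerms c {fromℝ (K (σ u) (σ v))} {fromℝ (K u v)} (K-inv u v , termwise λ _ → refl)

  -- As `σ` fixes `a`, the basis vector at `a` is invariant too. Summed over `w`, this shows that
  -- the column of `E` at `a` has equal entries at `σ u` and `u`.
  columnTerm-invariant : ∀ {E a} → LimitSums.Invariant E → σ a ≡ a → ∀ u w →
    E (σ u) (σ w) *ℂ indicator (a ≟ σ w) ≈ℂ E u w *ℂ indicator (a ≟ w)
  columnTerm-invariant {E} {a} E-inv σa≡a u w =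
    subst (λ x → E (σ u) (σ w) *ℂ x ≈ℂ E u w *ℂ indicator (a ≟ w))
      (sym (trans (cong (λ v → indicator (v ≟ σ w)) (sym σa≡a))
        (indicator-cong (σ a ≟ σ w) (a ≟ w) (does-≟-invariant a w))))
      (≋⇒≈ℂ (*ℂ-congˡ-01 {indicator (a ≟ w)} {E (σ u) (σ w)} {E u w}
        (indicator-01 (a ≟ w)) (E-inv u w)))

  ∑-≈-unique : ∀ {f g} z w → (∀ v → f (σ v) ≋ℂ g v) → ∑ f ≈ℂ z → ∑ g ≈ℂ w → z ≋ℂ w
  ∑-≈-unique {f} {g} z w fσ≋g ∑f≈z ∑g≈w =
    ≋ℂ.trans {z} {∑ f} {w} (≋ℂ.sym {∑ f} {z} (≈⇒≋ℂ ∑f≈z))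
      (≋ℂ.trans {∑ f} {∑ g} {w} (LimitSums.∑-invariant {f} {g} fσ≋g) (≈⇒≋ℂ ∑g≈w))

  -- The column of `E` at `a` is invariant under `σ` and equals `γ` times the basis vector at `b`.
  -- If `σ b ≢ b`, comparing its entries at `σ b` and `b` makes `γ` vanish, against its modulus 1.
  PST⇒fixes-target : ∀ {K a b} → RealSums.Invariant K → PST V K a b → σ a ≡ a → ¬ (σ b ≢ b)
  PST⇒fixes-target {K} {a} {b} K-inv (τ , _ , γ , ∣γ∣≡1 , E , isExp , transfer) σa≡a σb≢b =
    modulus-1⇒≉0 γ ∣γ∣≡1
      (≋ℂ.trans {γ} {γ *ℂ 1ℂ} {0ℂ} (≋ℂ.sym {γ *ℂ 1ℂ} {γ} (*ℂ-identityʳ γ))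
        (≋ℂ.trans {γ *ℂ 1ℂ} {γ *ℂ 0ℂ} {0ℂ} (≋ℂ.sym {γ *ℂ 0ℂ} {γ *ℂ 1ℂ} γ0≋γ1) (*ℂ-zeroʳ γ)))
    where
    E-inv : LimitSums.Invariant E
    -- Invariance passes from `K` to its scalar multiple, then to the terms of the exponential
    -- series, and finally to the limit of the partial sums.
    E-inv = limit-invariant E
      (λ k u v → sameTerms⇒≐ℂ (expTerm-invariant
        (λ u v → sameTerms⇒≐ℂ (scaled-invariant K-inv (-ℂ (𝕚 *ℂ fromℝ τ)) u v)) k u v))
      isExp

    γ0≋γ1 : γ *ℂ 0ℂ ≋ℂ γ *ℂ 1ℂ
    γ0≋γ1 = subst₂ (λ x y → γ *ℂ x ≋ℂ γ *ℂ y)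
      (indicator-no (b ≟ σ b) (σb≢b ∘ sym)) (indicator-yes (b ≟ b) refl)
      (∑-≈-unique (γ *ℂ indicator (b ≟ σ b)) (γ *ℂ indicator (b ≟ b))
        (λ w → ≈⇒≋ℂ (columnTerm-invariant E-inv σa≡a b w))
        (transfer (σ b)) (transfer b))

-- Automorphisms of the Hamming graph

-- Witness against PST: an involutive automorphism in the stabiliser of `a` that moves `b`.
-- Preservation of all distances, and not just of adjacency, lets `separator-∷` add a coordinate by
-- adding its letter distance.
record Separator {d q} (a b : Word d q) : Set where
  field
    σ          : Word d q → Word d q
    involutive : ∀ w → σ (σ w) ≡ w
    isometric  : ∀ u v → hammingDistance (σ u) (σ v) ≡ hammingDistance u v
    fixes      : σ a ≡ a
    moves      : σ b ≢ b

-- Adjacency is a condition on the Hamming distance, so an isometry leaves the adjacency matrix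
-- invariant, and with it every power.
separator⇒¬PST : ∀ {d q} k {a b : Word d q} → Separator a b →
  ¬ PST (wordSet d q) (adjacencyPower d q k) a b
separator⇒¬PST {d} {q} k {a} {b} s pst =
  PST⇒fixes-target {adjacencyPower d q k} {a} {b} (λ u v → power-invariant k u v) pst fixes moves
  where
  open Separator s
  open Invariance (wordSet d q) σ involutive

  adjacency-invariant : RealSums.Invariant (adjacencyMatrix (hammingGraph d q))
  adjacency-invariant u v = termwise λ n →
    cong (λ m → seq (if does (m ℕ.≟ 1) then 1ℝ else 0ℝ) n) (isometric u v)

  power-invariant : ∀ k → RealSums.Invariant (adjacencyPower d q k)
  power-invariant = RealPowers.^-invariant {adjacencyMatrix (hammingGraph d q)} adjacency-invariant

-- Transpositions of letters and letter distances

transpose-left : ∀ {q} (i j : Fin q) → transpose i j i ≡ j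
transpose-left i j rewrite dec-true (i Fin.≟ i) refl = refl

transpose-right : ∀ {q} (i j : Fin q) → transpose i j j ≡ i
transpose-right i j with j Fin.≟ i
-- `transpose` tests for `i` first, so in this case it returns `j`.
... | yes j≡i = j≡i
... | no _ rewrite dec-true (j Fin.≟ j) refl = refl

transpose-other : ∀ {q} {i j k : Fin q} → k ≢ i → k ≢ j → transpose i j k ≡ k
transpose-other {i = i} {j} {k} k≢i k≢j
  rewrite dec-false (k Fin.≟ i) k≢i | dec-false (k Fin.≟ j) k≢j = refl

transpose-involutive : ∀ {q} (i j k : Fin q) → transpose i j (transpose i j k) ≡ k
transpose-involutive i j k with k Fin.≟ i
... | yes refl = transpose-right i j
... | no k≢i with k Fin.≟ j
...   | yes refl = transpose-left i j
...   | no k≢j   = transpose-other k≢i k≢j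

transpose-injective : ∀ {q} (i j : Fin q) {k l} → transpose i j k ≡ transpose i j l → k ≡ l
transpose-injective i j {k} {l} eq =
  trans (sym (transpose-involutive i j k))
    (trans (cong (transpose i j) eq) (transpose-involutive i j l))

-- The share of one coordinate in `hammingDistance`, in the form to which that function unfolds.
letterDistance : ∀ {q} → Fin q → Fin q → ℕ
letterDistance x y = if does (x Fin.≟ y) then 0 else 1

letterDistance-transpose : ∀ {q} (i j x y : Fin q) →
  letterDistance (transpose i j x) (transpose i j y) ≡ letterDistance x y
letterDistance-transpose i j x y = cong (if_then 0 else 1)
  (does-⇔ (mk⇔ (transpose-injective i j) (cong (transpose i j)))
    (transpose i j x Fin.≟ transpose i j y) (x Fin.≟ y))

≡⇒letterDistance≡0 : ∀ {q} {x y : Fin q} → x ≡ y → letterDistance x y ≡ 0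
≡⇒letterDistance≡0 {x = x} {y} x≡y = cong (if_then 0 else 1) (dec-true (x Fin.≟ y) x≡y)

≢⇒letterDistance≡1 : ∀ {q} {x y : Fin q} → x ≢ y → letterDistance x y ≡ 1
≢⇒letterDistance≡1 {x = x} {y} x≢y = cong (if_then 0 else 1) (dec-false (x Fin.≟ y) x≢y)

letterDistance≡0⇒≡ : ∀ {q} {x y : Fin q} → letterDistance x y ≡ 0 → x ≡ y
letterDistance≡0⇒≡ {x = x} {y} eq with x Fin.≟ y
... | yes x≡y = x≡y
... | no _    = contradiction eq λ ()

hammingDistance≤length : ∀ {d q} (u v : Word d q) → hammingDistance u v ≤ d
hammingDistance≤length []      []      = ℕ.≤-refl
hammingDistance≤length (x ∷ u) (y ∷ v) with x Fin.≟ y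
... | yes _ = ℕ.m≤n⇒m≤1+n (hammingDistance≤length u v)
... | no _  = s≤s (hammingDistance≤length u v)

-- With equal heads the whole distance `suc d` would have to come from tails of length `d`.
antipodal⇒heads-differ : ∀ {d q} (x y : Fin q) (a b : Word d q) →
  Antipodal (x ∷ a) (y ∷ b) → letterDistance x y ≡ 1
antipodal⇒heads-differ x y a b antipodal with x Fin.≟ y
... | yes _ = contradiction (subst (_≤ _) antipodal (hammingDistance≤length a b)) ℕ.1+n≰n
... | no _  = refl

-- Construction of separators

separator-∷ : ∀ {d q} (x y : Fin q) {a b : Word d q} →
  Separator a b → Separator (x ∷ a) (y ∷ b)
separator-∷ x y s = record
  { σ          = λ { (z ∷ w) → z ∷ σ w }
  ; involutive = λ { (z ∷ w) → cong (z ∷_) (involutive w) }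
  ; isometric  = λ { (z ∷ u) (z′ ∷ v) → cong (letterDistance z z′ ℕ.+_) (isometric u v) }
  ; fixes      = cong (x ∷_) fixes
  ; moves      = moves ∘ Vec.∷-injectiveʳ
  }
  where open Separator s

-- Exchanging `y` and `z` in the first coordinate leaves `x` alone and turns `y` into `z`.
transposeHead : ∀ {d q} {x y z : Fin q} {a b : Word d q} →
  x ≢ y → x ≢ z → z ≢ y → Separator (x ∷ a) (y ∷ b)
transposeHead {x = x} {y} {z} {a} x≢y x≢z z≢y = record
  { σ          = λ { (l ∷ w) → transpose y z l ∷ w }
  ; involutive = λ { (l ∷ w) → cong (_∷ w) (transpose-involutive y z l) }
  ; isometric  = λ { (l ∷ u) (m ∷ v) →
      cong (ℕ._+ hammingDistance u v) (letterDistance-transpose y z l m) }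
  ; fixes      = cong (_∷ a) (transpose-other x≢y x≢z)
  ; moves      = λ eq → z≢y (trans (sym (transpose-left y z)) (Vec.∷-injectiveˡ eq))
  }

-- The first two coordinates are exchanged and both relabelled by the transposition `ρ` of `x` and
-- `x′`, which restores the word starting with these letters. Were the other word fixed, `ρ` would
-- carry the pair `x`, `y` to `x′`, `y′`, and the two letter distances would agree.
exchangeHeads : ∀ {d q} {x x′ y y′ : Fin q} {a b : Word d q} →
  letterDistance x y ≢ letterDistance x′ y′ → Separator (x ∷ x′ ∷ a) (y ∷ y′ ∷ b)
exchangeHeads {d} {q} {x} {x′} {y} {y′} {a} {b} ≢-distances = record
  { σ          = exchange
  ; involutive = λ { (l ∷ m ∷ w) →
      cong₂ (λ l m → l ∷ m ∷ w) (transpose-involutive x x′ l) (transpose-involutive x x′ m) }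
  ; isometric  = isometric
  ; fixes      = cong₂ (λ l m → l ∷ m ∷ a) (transpose-right x x′) (transpose-left x x′)
  ; moves      = λ eq → ≢-distances
      (trans (sym (letterDistance-transpose x x′ x y))
        (cong₂ letterDistance (transpose-left x x′) (Vec.∷-injectiveˡ (Vec.∷-injectiveʳ eq))))
  }
  where
  open CommutativeSemigroup ℕ.+-commutativeSemigroup using (x∙yz≈y∙xz)

  ρ : Fin q → Fin q
  ρ = transpose x x′

  exchange : Word (2 ℕ.+ d) q → Word (2 ℕ.+ d) q
  exchange (l ∷ m ∷ w) = ρ m ∷ ρ l ∷ w

  isometric : ∀ u v → hammingDistance (exchange u) (exchange v) ≡ hammingDistance u v
  isometric (l ∷ m ∷ u) (l′ ∷ m′ ∷ v) = trans
    (cong₂ (λ i j → i ℕ.+ (j ℕ.+ hammingDistance u v))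
      (letterDistance-transpose x x′ m m′) (letterDistance-transpose x x′ l l′))
    (x∙yz≈y∙xz (letterDistance m m′) (letterDistance l l′) (hammingDistance u v))

thirdLetter : ∀ {q} → 3 ≤ q → (x y : Fin q) → ∃ λ z → x ≢ z × z ≢ y
thirdLetter (s≤s (s≤s (s≤s _))) zero          zero          = suc zero , (λ ()) , (λ ())
thirdLetter (s≤s (s≤s (s≤s _))) zero          (suc zero)    = suc (suc zero) , (λ ()) , (λ ())
thirdLetter (s≤s (s≤s (s≤s _))) zero          (suc (suc _)) = suc zero , (λ ()) , (λ ())
thirdLetter (s≤s (s≤s (s≤s _))) (suc zero)    zero          = suc (suc zero) , (λ ()) , (λ ())
thirdLetter (s≤s (s≤s (s≤s _))) (suc (suc _)) zero          = suc zero , (λ ()) , (λ ())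
thirdLetter (s≤s (s≤s (s≤s _))) (suc _)       (suc _)       = zero , (λ ()) , (λ ())

separator-thirdLetter : ∀ {d q} → 3 ≤ q → (a b : Word d q) → a ≢ b → Separator a b
separator-thirdLetter 3≤q []      []      []≢[] = contradiction refl []≢[]
separator-thirdLetter 3≤q (x ∷ a) (y ∷ b) xa≢yb with x Fin.≟ y
... | yes x≡y = separator-∷ x y (separator-thirdLetter 3≤q a b (xa≢yb ∘ cong₂ _∷_ x≡y))
... | no x≢y  = let z , x≢z , z≢y = thirdLetter 3≤q x y in transposeHead x≢y x≢z z≢y

-- If exactly one of the first two coordinates shows agreement, these two are exchanged. Otherwise
-- the heads agree just when the next letters do, so equal or antipodal tails would make the whole
-- words equal or antipodal; hence the tails satisfy the hypotheses again. The recursive call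
-- arrives as `tail-separator`, which keeps the structural descent in `separator-nonAntipodal`.
separator-step : ∀ {d q} (x x′ y y′ : Fin q) (as bs : Word d q) →
  let a = x′ ∷ as; b = y′ ∷ bs in
  x ∷ a ≢ y ∷ b → ¬ Antipodal (x ∷ a) (y ∷ b) →
  (a ≢ b → ¬ Antipodal a b → Separator a b) → Separator (x ∷ a) (y ∷ b)
separator-step x x′ y y′ as bs xa≢yb ¬antipodal tail-separator
  with letterDistance x y ℕ.≟ letterDistance x′ y′
... | no ≢-distances = exchangeHeads ≢-distances
... | yes ≡-distances = separator-∷ x y (tail-separator
  (λ a≡b → xa≢yb (cong₂ _∷_
    (letterDistance≡0⇒≡ (trans ≡-distances (≡⇒letterDistance≡0 (Vec.∷-injectiveˡ a≡b)))) a≡b))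
  (λ antipodal → ¬antipodal (cong₂ ℕ._+_
    (trans ≡-distances (antipodal⇒heads-differ x′ y′ as bs antipodal)) antipodal)))

separator-nonAntipodal : ∀ {d q} (a b : Word d q) → a ≢ b → ¬ Antipodal a b → Separator a b
separator-nonAntipodal [] [] []≢[] _ = contradiction refl []≢[]
-- Distinct words of length one are already antipodal; the `0` is the distance of the empty tails.
separator-nonAntipodal (x ∷ []) (y ∷ []) x≢y ¬antipodal = contradiction
  (cong (ℕ._+ 0) (≢⇒letterDistance≡1 (x≢y ∘ cong (_∷ [])))) ¬antipodal
separator-nonAntipodal (x ∷ x′ ∷ as) (y ∷ y′ ∷ bs) a≢b ¬antipodal =
  separator-step x x′ y y′ as bs a≢b ¬antipodal (separator-nonAntipodal (x′ ∷ as) (y′ ∷ bs))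

proposition5p2 : (d q : ℕ) → 1 ≤ d → 2 ≤ q →
    (3 ≤ q → (k : ℕ) → 1 ≤ k → (a b : Word d q) → a ≢ b →
    ¬ PST (wordSet d q) (adjacencyPower d q k) a b)
    ×
    (q ≡ 2 → (k : ℕ) → 1 ≤ k → (a b : Word d q) → a ≢ b →
    PST (wordSet d q) (adjacencyPower d q k) a b → Antipodal a b)
proposition5p2 d q _ _ =
  (λ 3≤q k _ a b a≢b → separator⇒¬PST k (separator-thirdLetter 3≤q a b a≢b)) ,
  -- Antipodality is a decidable equation of natural numbers, so refuting its negation proves it.
  (λ _ k _ a b a≢b pst → decidable-stable (hammingDistance a b ℕ.≟ d) λ ¬antipodal →
    separator⇒¬PST k (separator-nonAntipodal a b a≢b ¬antipodal) pst)
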